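{- Let $\mathcal{M}=(W,\preceq,V)$ and $\mathcal{N}=(W,\preceq^{\mathcal N},V)$ be the two single-agent ($Ag=\{a\}$) plausibility models with $W=\{w,v\}$, $w\neq v$, $V(p)=\{v\}$ (so $p$ is false at $w$ and true at $v$), where $\preceq_a=\{(w,w),(v,v),(w,v)\}$ (so $w$ is strictly more plausible than $v$ in $\mathcal{M}$) and $\preceq_a^{\mathcal N}=W\times W$ (so $w$ and $v$ are equally plausible in $\mathcal{N}$). Then there is no plausibility event model $\mathcal{E}$ such that $\mathcal{M}\ast\mathcal{E}\equiv\mathcal{N}$, where $\ast$ denotes plausibility update and $\equiv$ denotes modal equivalence with respect to the doxastic language $\mathcal{L}$.
   Context: Language. $At$ is a countable set of atoms (with $p\in At$), $Ag$ a finite set of agents. The doxastic language $\mathcal{L}$ is given by $\varphi::=\top\mid p\mid\neg\varphi\mid\varphi\wedge\varphi\mid B_a\varphi$ with $p\in At$, $a\in Ag$. Plausibility models. A plausibility order on a set $S$ is a connected (total), reflexive and transitive relation $\trianglelefteq\subseteq S\times S$ such that every non-empty $S'\subseteq S$ has a minimal element, i.e. $Min_{\trianglelefteq}(S')=\{w\in S':\forall v\in S',\ w\trianglelefteq v\}\neq\emptyset$. A plausibility model is a triple $(W,\preceq,V)$ with $W\neq\emptyset$, $\preceq_a$ a plausibility order on $W$ for each $a\in Ag$ ($x\preceq_a y$ means $x$ is at least as plausible as $y$), and $V:At\to\wp(W)$. Semantics: atoms and Boolean connectives as usual, and $\mathcal{M},w\vDash B_a\varphi$ iff $\mathcal{M},v\vDash\varphi$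 for all $v\in Min_{\preceq_a}(W)$. Plausibility event models. A plausibility event model is $\mathcal{E}=(E,\leq,pre)$ with $E$ a non-empty finite set, $\leq_a$ a plausibility order on $E$ for each $a\in Ag$, and $pre:E\to\mathcal{L}$. Write $e<_a f$ for $e\leq_a f$ and $f\not\leq_a e$, and $e\equiv_a f$ for $e\leq_a f$ and $f\leq_a e$. Plausibility update. $\mathcal{M}\ast\mathcal{E}=(W^{\mathcal E},\preceq^{\mathcal E},V^{\mathcal E})$ where $W^{\mathcal E}=\{(w,e)\in W\times E:\mathcal{M},w\vDash pre(e)\}$; $(w,e)\preceq_a^{\mathcal E}(v,f)$ iff $e<_a f$, or $e\equiv_a f$ and $w\preceq_a v$; and $V^{\mathcal E}(p)=\{(w,e)\in W^{\mathcal E}:w\in V(p)\}$. Modal equivalence. Two models $\mathcal{K}$ and $\mathcal{K}'$ with sets of worlds $W,W'$ are modally equivalent with respect to $\mathcal{L}$, written $\mathcal{K}\equiv\mathcal{K}'$, if for every formula $\varphi\in\mathcal{L}$ and every $w\in W$ there exists $w'\in W'$ such that $\mathcal{K},w\vDash\varphi$ iff $\mathcal{K}',w'\vDash\varphi$, and conversely, for every $w'\in W'$ there exists $w\in W$ with the same property. -}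

module Defs where

open import Data.Empty using (⊥-elim)
open import Data.Fin.Base using (Fin)
open import Data.Nat.Base using (ℕ)
open import Data.Product.Base using (Σ; ∃; ∃-syntax; _×_; _,_; proj₁; proj₂)
open import Data.Refinement.Base using (Refinement-syntax; value)
open import Data.Sum.Base using (_⊎_; inj₁; inj₂)
open import Data.Unit.Base using (⊤; tt)
open import Function.Base using (_∘_)
open import Function.Bundles using (_⇔_; _↔_)
open import Level using (0ℓ)
open import Relation.Binary.Core using (Rel)
open import Relation.Binary.PropositionalEquality.Core using (_≡_; refl)
open import Relation.Binary.PropositionalEquality.Properties using (isEquivalence)
open import Relation.Binary.Structures using (IsTotalPreorder)
open import Relation.Nullary.Negation.Core using (¬_)
open import Relation.Unary using (Pred; _∈_; U; Empty)

infix  4 _≢∅ _,_⊨_ _≡ᴹ_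
infixl 6 _⊛_
infixr 7 _∧ᶠ_
infix  8 ¬ᶠ_

private
  variable
    At Ag : Set

-- "Non-empty" is read literally as "not empty".  Asking for an element instead
-- would, by the minimality clause of IsPlausibilityOrder, decide P whenever one
-- of two elements is strictly below the other (take S' = {below | P} ∪ {above}),
-- so that no non-trivial order could be exhibited constructively.
_≢∅ : {S : Set} → Pred S 0ℓ → Set
P ≢∅ = ¬ Empty P

Min : {S : Set} → Rel S 0ℓ → Pred S 0ℓ → Pred S 0ℓ
Min _⊴_ S' x = x ∈ S' × (∀ y → y ∈ S' → x ⊴ y)

record IsPlausibilityOrder {S : Set} (_⊴_ : Rel S 0ℓ) : Set₁ where
  field
    isTotalPreorder : IsTotalPreorder _≡_ _⊴_
    minimal         : (S' : Pred S 0ℓ) → S' ≢∅ → Min _⊴_ S' ≢∅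

data Form (At Ag : Set) : Set where
  ⊤ᶠ   : Form At Ag
  atom : At → Form At Ag
  ¬ᶠ_  : Form At Ag → Form At Ag
  _∧ᶠ_ : Form At Ag → Form At Ag → Form At Ag
  B    : Ag → Form At Ag → Form At Ag

-- Only the data of a plausibility model: a plausibility update may have no
-- worlds at all, in which case it is not a plausibility model.
record Model (At Ag : Set) : Set₁ where
  field
    W : Set
    ⪯ : Ag → Rel W 0ℓ
    V : At → Pred W 0ℓ

record PlausibilityModel (At Ag : Set) : Set₁ where
  field
    model : Model At Ag
  open Model model public
  field
    nonEmpty            : U {A = W} ≢∅
    isPlausibilityOrder : ∀ a → IsPlausibilityOrder (⪯ a)

open PlausibilityModel using (model)

_,_⊨_ : (K : Model At Ag) → Model.W K → Form At Ag → Set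
K , x ⊨ ⊤ᶠ       = ⊤
K , x ⊨ atom p   = x ∈ Model.V K p
K , x ⊨ (¬ᶠ φ)   = ¬ (K , x ⊨ φ)
K , x ⊨ (φ ∧ᶠ ψ) = (K , x ⊨ φ) × (K , x ⊨ ψ)
K , x ⊨ B a φ    = ∀ y → y ∈ Min (Model.⪯ K a) U → K , y ⊨ φ

record EventModel (At Ag : Set) : Set₁ where
  field
    E                   : Set
    ≤                   : Ag → Rel E 0ℓ
    pre                 : E → Form At Ag
    nonEmpty            : U {A = E} ≢∅
    finite              : ∃[ n ] (E ↔ Fin n)
    isPlausibilityOrder : ∀ a → IsPlausibilityOrder (≤ a)

  infix 4 _<[_]_ _≡[_]_

  _<[_]_ : E → Ag → E → Set
  e <[ a ] f = ≤ a e f × ¬ ≤ a f e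

  _≡[_]_ : E → Ag → E → Set
  e ≡[ a ] f = ≤ a e f × ≤ a f e

-- The worlds form a refinement type rather than a Σ-type, so that a pair (x , e)
-- counts once, however many proofs there are that x satisfies pre e.
_⊛_ : PlausibilityModel At Ag → EventModel At Ag → Model At Ag
_⊛_ {At} {Ag} M 𝓔 = record
  { W = Wᴱ
  ; ⪯ = λ a s t → (event s <[ a ] event t)
                ⊎ (event s ≡[ a ] event t × ⪯ a (world s) (world t))
  ; V = λ p s → world s ∈ V p
  }
  where
  open PlausibilityModel M using (W; ⪯; V)
  open EventModel 𝓔 using (E; pre; _<[_]_; _≡[_]_)

  Wᴱ : Set
  Wᴱ = [ s ∈ W × E ∣ (model M , proj₁ s ⊨ pre (proj₂ s)) ]

  world : Wᴱ → W
  world s = proj₁ (value s)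

  event : Wᴱ → E
  event s = proj₂ (value s)

-- The formula is quantified first, so the matching world may depend on it.
_≡ᴹ_ : Model At Ag → Model At Ag → Set
_≡ᴹ_ {At} {Ag} K K' = (φ : Form At Ag) →
    (∀ x → ∃[ x' ] ((K , x ⊨ φ) ⇔ (K' , x' ⊨ φ)))
  × (∀ x' → ∃[ x ] ((K , x ⊨ φ) ⇔ (K' , x' ⊨ φ)))

data World : Set where
  w v : World

data _⪯ᴹ_ : Rel World 0ℓ where
  w⪯w : w ⪯ᴹ w
  v⪯v : v ⪯ᴹ v
  w⪯v : w ⪯ᴹ v

_⪯ᴺ_ : Rel World 0ℓ
x ⪯ᴺ y = ⊤

⪯ᴹ-isPlausibilityOrder : IsPlausibilityOrder _⪯ᴹ_
⪯ᴹ-isPlausibilityOrder = record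
  { isTotalPreorder = record
    { isPreorder = record
      { isEquivalence = isEquivalence
      ; reflexive     = λ { {w} refl → w⪯w ; {v} refl → v⪯v }
      ; trans         = trans
      }
    ; total = total
    }
  ; minimal = minimal
  }
  where
  trans : ∀ {x y z} → x ⪯ᴹ y → y ⪯ᴹ z → x ⪯ᴹ z
  trans w⪯w q   = q
  trans v⪯v q   = q
  trans w⪯v v⪯v = w⪯v

  total : ∀ x y → x ⪯ᴹ y ⊎ y ⪯ᴹ x
  total w w = inj₁ w⪯w
  total w v = inj₁ w⪯v
  total v w = inj₂ w⪯v
  total v v = inj₁ v⪯v

  minimal : (S' : Pred World 0ℓ) → S' ≢∅ → Min _⪯ᴹ_ S' ≢∅
  minimal S' S'≢∅ noMin = S'≢∅ λ { w → w∉S' ; v → v∉S' }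
    where
    w∉S' : ¬ S' w
    w∉S' w∈S' = noMin w (w∈S' , λ { w _ → w⪯w ; v _ → w⪯v })

    v∉S' : ¬ S' v
    v∉S' v∈S' = noMin v (v∈S' , λ { w w∈S' → ⊥-elim (w∉S' w∈S') ; v _ → v⪯v })

⪯ᴺ-isPlausibilityOrder : IsPlausibilityOrder _⪯ᴺ_
⪯ᴺ-isPlausibilityOrder = record
  { isTotalPreorder = record
    { isPreorder = record
      { isEquivalence = isEquivalence
      ; reflexive     = λ _ → tt
      ; trans         = λ _ _ → tt
      }
    ; total = λ _ _ → inj₁ tt
    }
  ; minimal = λ S' S'≢∅ noMin → S'≢∅ λ x x∈S' → noMin x (x∈S' , λ _ _ → tt)
  }

-- Ag = ⊤ is the singleton set of agents.
𝓜 : (At → Pred World 0ℓ) → PlausibilityModel At ⊤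
𝓜 V = record
  { model               = record { W = World ; ⪯ = λ _ → _⪯ᴹ_ ; V = V }
  ; nonEmpty            = λ empty → empty w tt
  ; isPlausibilityOrder = λ _ → ⪯ᴹ-isPlausibilityOrder
  }

𝓝 : (At → Pred World 0ℓ) → PlausibilityModel At ⊤
𝓝 V = record
  { model               = record { W = World ; ⪯ = λ _ → _⪯ᴺ_ ; V = V }
  ; nonEmpty            = λ empty → empty w tt
  ; isPlausibilityOrder = λ _ → ⪯ᴺ-isPlausibilityOrder
  }

{-# OPTIONS --safe #-}

-- 𝓝 satisfies ¬B p ∧ ¬B ¬p, so 𝓜 ⊛ 𝓔 would need a minimal world over v and a
-- minimal world over w.  These lie below each other, which forces their events
-- to be equally plausible and then v ⪯ᴹ w.
module Submission where

open import Defs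
open import Data.Nat.Base using (ℕ)
open import Data.Product.Base using (∃-syntax; _,_; proj₁; proj₂)
open import Data.Refinement.Base using (value)
open import Data.Sum.Base using (inj₁; inj₂)
open import Data.Unit.Base using (⊤; tt)
open import Function.Bundles using (_↣_; Equivalence)
open import Level using (0ℓ)
open import Relation.Binary.PropositionalEquality.Core using (_≡_; refl; sym)
open import Relation.Nullary.Negation.Core using (¬_; contradiction)
open import Relation.Unary using (Pred; _∈_; U; _≐_; ｛_｝)

undecided : {At Ag : Set} → Ag → Form At Ag → Form At Ag
undecided a φ = (¬ᶠ B a φ) ∧ᶠ (¬ᶠ B a (¬ᶠ φ))

≢w⇒≡v : ∀ {x} → ¬ (x ≡ w) → x ≡ v
≢w⇒≡v {w} w≢w = contradiction refl w≢w
≢w⇒≡v {v} _   = refl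

v⋠w : ∀ {x y} → x ≡ w → y ≡ v → ¬ (y ⪯ᴹ x)
v⋠w refl refl ()

module _ {At : Set} (V : At → Pred World 0ℓ) where

  -- Both worlds are minimal under `_⪯ᴺ_`: `w` refutes belief in `p`, and `v` refutes belief in its
  -- negation.
  𝓝-undecided : ∀ {p} → V p ≐ ｛ v ｝ →
                PlausibilityModel.model (𝓝 V) , w ⊨ undecided tt (atom p)
  𝓝-undecided (Vp⊆v , v⊆Vp) =
      (λ Bp  → contradiction (Vp⊆v (Bp w (tt , λ _ _ → tt))) λ ())
    , (λ B¬p → B¬p v (tt , λ _ _ → tt) (v⊆Vp refl))

  module _ (𝓔 : EventModel At ⊤) where

    open Model (𝓜 V ⊛ 𝓔) using (W; ⪯)

    world : W → World
    world s = proj₁ (value s)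

    not-tied : ∀ s t → world s ≡ w → world t ≡ v → ⪯ tt s t → ¬ ⪯ tt t s
    not-tied _ _ _   _   (inj₁ (_ , f≰e))       (inj₁ (f≤e , _))       = f≰e f≤e
    not-tied _ _ _   _   (inj₂ ((e≤f , _) , _)) (inj₁ (_ , e≰f))       = e≰f e≤f
    not-tied _ _ _   _   (inj₁ (_ , f≰e))       (inj₂ ((f≤e , _) , _)) = f≰e f≤e
    -- Each case above sets a strict comparison of events against its converse; here only the worlds
    -- are left to compare.
    not-tied _ _ s↦w t↦v (inj₂ _)               (inj₂ (_ , t⪯s))       = v⋠w s↦w t↦v t⪯s

    minimal-over-v : ∀ s t → s ∈ Min (⪯ tt) U → t ∈ Min (⪯ tt) U →
                     world t ≡ v → world s ≡ v
    minimal-over-v s t (_ , s≤) (_ , t≤) t↦v =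
      ≢w⇒≡v λ s↦w → not-tied s t s↦w t↦v (s≤ t tt) (t≤ s tt)

    -- A negated belief yields no witness constructively, so no pair of minimal worlds is extracted.
    -- Instead, a single minimal world satisfying `p` puts every minimal world over `v`, so `p` is
    -- believed, against `¬Bp`. Hence no minimal world satisfies `p`, against `¬B¬p`.
    ⊛-decided : ∀ {p} → V p ≐ ｛ v ｝ →
                ∀ x → ¬ (𝓜 V ⊛ 𝓔 , x ⊨ undecided tt (atom p))
    ⊛-decided (Vp⊆v , v⊆Vp) x (¬Bp , ¬B¬p) =
      ¬B¬p λ t t-min pt → ¬Bp λ s s-min →
        v⊆Vp (sym (minimal-over-v s t s-min t-min (sym (Vp⊆v pt))))

theorem3p2 : (At : Set) → At ↣ ℕ →
    (p : At) (V : At → Pred World 0ℓ) → V p ≐ ｛ v ｝ →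
    ¬ (∃[ 𝓔 ] (𝓜 V ⊛ 𝓔 ≡ᴹ PlausibilityModel.model (𝓝 V)))
theorem3p2 At _ p V Vp≐v (𝓔 , equiv) =
  -- Beliefs do not depend on the world of evaluation, so `w` is an arbitrary choice in `𝓝`.
  let x , x⇔w = proj₂ (equiv (undecided tt (atom p))) w
  in ⊛-decided V 𝓔 Vp≐v x (Equivalence.from x⇔w (𝓝-undecided V Vp≐v))
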